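{- (M-EXP) The following type is inhabited: $$\prod_{a:M}\ \prod_{b:M}\ \sum_{c:M}\ \prod_{z:M}\ \Bigl(z\in c\;\simeq\;\mathrm{Operation}_{a\,b}\,z\Bigr).$$
   Context: The setting is Martin-Löf (homotopy/univalent) type theory with the Univalence Axiom (hence function extensionality); $A:\mathrm{Set}$ means "$A$ is a type" (not necessarily a 0-type), $A\simeq B$ is the type of equivalences as in the Homotopy Type Theory book, and $\wedge$ denotes the product type $\times$ (propositions-as-types). $U:\mathrm{Set}$ is a univalent universe with decoding function $T:U\to\mathrm{Set}$; univalent means that for $a,b:U$ the canonical map $\mathrm{Id}_U\,a\,b\to (T\,a\simeq T\,b)$ is an equivalence. $U$ is assumed closed under $+$, $\Sigma$-, $\Pi$- (hence function) and identity types, and to contain codes for the empty type $0$, the unit type $1$ and the two-element type $2=1+1$. $M := W_{a:U}\,T\,a$ is the W-type with canonical elements $\sup\,a\,f$, where $a:U$ and $f:T\,a\to M$. The relation $=_M\,:M\to M\to\mathrm{Set}$ is defined by recursion: $$(\sup\,a\,f)=_M(\sup\,b\,g)\;:=\;\sum_{\alpha:T a\simeq T b}\ \prod_{x:T a}\ (f\,x)=_M\bigl(g\,(\alpha\,x)\bigr).$$ The relation $\in\,:M\to M\to\mathrm{Set}$ is defined by $$x\in(\sup\,b\,g)\;:=\;\sum_{i:T b}\ x=_M(g\,i).$$ Constructions: $\emptyset:=\sup\,0\,(\text{the unique map } 0\to M)$; $\{a\}:=\sup\,1\,(\lambda i.\,a)$; $\{a,b\}:=\sup\,2\,(p\,a\,b)$,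 where $p\,a\,b:2\to M$ sends the left element of $2=1+1$ to $a$ and the right element to $b$. Ordered pairs are given by Wiener's encoding $\langle a,b\rangle:=\{\{\{a\},\emptyset\},\{\{b\}\}\}$. For $a,b,f:M$, the type $\mathrm{Operation}_{a\,b}\,f$ ("$f$ is a multiset operation from $a$ to $b$") is the product of three factors, with all variables ranging over $M$: $$\mathrm{Operation}_{a\,b}\,f:=\Bigl(\prod_{z}\bigl(z\in f\to\sum_x\sum_y z=_M\langle x,y\rangle\bigr)\Bigr)\wedge\Bigl(\prod_x\bigl(x\in a\simeq\sum_y\langle x,y\rangle\in f\bigr)\Bigr)\wedge\Bigl(\prod_y\bigl((\sum_x\langle x,y\rangle\in f)\to y\in b\bigr)\Bigr).$$ -}

{-# OPTIONS --without-K #-}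

-- Axiom K refutes univalence of a universe with a code for ⊤ ⊎ ⊤, so results
-- assuming univalence are meaningful only in modules checked --without-K.

module Defs where

open import Data.Container.Core using (_▷_)
open import Data.Empty using (⊥; ⊥-elim)
open import Data.Product.Base using (Σ-syntax; ∃-syntax; _×_; _,_)
open import Data.Sum.Base using (_⊎_; [_,_])
open import Data.Unit.Base using (⊤)
open import Data.Universe using (Universe)
open import Data.W using (W; sup)
open import Function.Base using (_∘_; const; id)
open import Function.Properties.Inverse.HalfAdjointEquivalence using (_≃_)
open import Level using (Level; 0ℓ; _⊔_) renaming (suc to lsuc)
open import Relation.Binary.PropositionalEquality using (_≡_; refl)

private
  variable
    a b u e : Level

≃-refl : {A : Set a} → A ≃ A
≃-refl = record
  { to               = id
  ; from             = id
  ; left-inverse-of  = λ _ → refl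
  ; right-inverse-of = λ _ → refl
  ; left-right       = λ _ → refl
  }

IsEquivalence : {A : Set a} {B : Set b} → (A → B) → Set (a ⊔ b)
IsEquivalence {A = A} {B = B} f = Σ[ α ∈ A ≃ B ] (_≃_.to α ≡ f)

module _ (V : Universe u e) where
  open Universe V renaming (El to T)

  ≡⇒≃ : (x y : U) → x ≡ y → T x ≃ T y
  ≡⇒≃ x .x refl = ≃-refl

  Univalent : Set (u ⊔ e)
  Univalent = (x y : U) → IsEquivalence (≡⇒≃ x y)

  -- Decoding is specified up to equivalence, not up to judgemental equality.
  HasCode : Set e → Set (u ⊔ e)
  HasCode A = Σ[ x ∈ U ] (T x ≃ A)

SetUniverse : (ℓ : Level) → Universe (lsuc ℓ) ℓ
SetUniverse ℓ = record { U = Set ℓ ; El = id }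

UnivalenceAxiom : (ℓ : Level) → Set (lsuc ℓ)
UnivalenceAxiom ℓ = Univalent (SetUniverse ℓ)

record Closed (V : Universe 0ℓ 0ℓ) : Set where
  open Universe V renaming (El to T)
  field
    𝟘-code : HasCode V ⊥
    𝟙-code : HasCode V ⊤
    𝟚-code : HasCode V (⊤ ⊎ ⊤)
    ⊎-code : (x y : U) → HasCode V (T x ⊎ T y)
    Σ-code : (x : U) (y : T x → U) → HasCode V (Σ[ i ∈ T x ] T (y i))
    Π-code : (x : U) (y : T x → U) → HasCode V ((i : T x) → T (y i))
    ≡-code : (x : U) (i j : T x) → HasCode V (i ≡ j)

module Multisets (V : Universe 0ℓ 0ℓ) (closed : Closed V) where
  open Universe V renaming (El to T)
  open Closed closed

  infix 4 _=ᴹ_ _∈_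

  M : Set
  M = W (U ▷ T)

  _=ᴹ_ : M → M → Set
  sup (x , f) =ᴹ sup (y , g) =
    Σ[ α ∈ T x ≃ T y ] ((i : T x) → f i =ᴹ g (_≃_.to α i))

  _∈_ : M → M → Set
  x ∈ sup (y , g) = Σ[ i ∈ T y ] (x =ᴹ g i)

  fromCode : {A : Set} → HasCode V A → (A → M) → M
  fromCode (x , α) f = sup (x , f ∘ _≃_.to α)

  ∅ : M
  ∅ = fromCode 𝟘-code ⊥-elim

  ⁅_⁆ : M → M
  ⁅ x ⁆ = fromCode 𝟙-code (const x)

  ⁅_&_⁆ : M → M → M
  ⁅ x & y ⁆ = fromCode 𝟚-code [ const x , const y ]

  -- Wiener's encoding, {{{x},∅},{{y}}}.
  ⟨_,_⟩ : M → M → M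
  ⟨ x , y ⟩ = ⁅ ⁅ ⁅ x ⁆ & ∅ ⁆ & ⁅ ⁅ y ⁆ ⁆ ⁆

  Operation : M → M → M → Set
  Operation a b f =
      ((z : M) → z ∈ f → ∃[ x ] ∃[ y ] (z =ᴹ ⟨ x , y ⟩))
    × ((x : M) → (x ∈ a) ≃ (∃[ y ] (⟨ x , y ⟩ ∈ f)))
    × ((y : M) → (∃[ x ] (⟨ x , y ⟩ ∈ f)) → y ∈ b)

{-# OPTIONS --without-K #-}
module Submission where

-- The exponential of sup (a , f) and sup (b , g) is the family of graphs of
-- functions h : T a → T b, where graph h consists of the pairs ⟨f i , g (h i)⟩
-- for i : T a. Membership of z in it is the type of all h together with an
-- equality z =ᴹ graph h, and Operation is shown to be equivalent to this type
-- (Operation↔graph).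
--
-- Univalence turns =ᴹ into the identity type (=ᴹ↔≡): both are reflexive and
-- have contractible total space, for =ᴹ by equivalence induction on the index
-- types and function extensionality on the families. Hence x ∈ sup (a , f) is
-- the fibre of f over x. Ordered pairing is an embedding (⟨,⟩-≡): multisets
-- indexed by A are equal along an equivalence of A, and the index types 0, 1
-- and 2 distinguish ∅, singletons and pairs, which leaves only the identity
-- equivalence and so the componentwise equalities.
--
-- Now let z = sup (c , r). The three factors of Operation unfold in turn.
--   * All elements of z are pairs: r i ≡ ⟨s i , t i⟩ for some s, t : T c → M,
--     by distributivity of Π over Σ.
--   * The fibres of f and of s are equivalent over each x, because y is
--     determined by the index of ⟨x , y⟩ in z. A fibrewise equivalence is the
--     same as an equivalence e : T a ≃ T c with f i ≡ s (e i) (fibrewise-≃).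
--   * The fibres of t map to those of g. A fibrewise map is the same as
--     k : T c → T b with t i ≡ g (k i) (fibrewise-map).
-- By univalence of the universe e may be taken to be the identity of T a; then
-- s and t are determined by f and g ∘ k, and what remains is k : T a → T b
-- together with an equality of r and the graph of k.

open import Defs
open import Axiom.UniquenessOfIdentityProofs using (UIP; module Decidable⇒UIP)
open import Data.Empty using (⊥; ⊥-elim)
open import Data.Product.Algebra using (×-cong)
open import Data.Product.Base using (Σ; Σ-syntax; ∃; ∃-syntax; _×_; _,_; proj₁; proj₂)
open import Data.Product.Function.Dependent.Propositional using (Σ-↔)
open import Data.Sum.Base using (inj₁; inj₂; [_,_])
open import Data.Sum.Properties using (≡-dec)
open import Data.Unit.Base using (tt)
open import Data.Unit.Properties using (_≟_)
open import Data.Universe using (Universe)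
open import Data.W using (sup)
open import Function.Base using (_∘_; id; const)
open import Function.Bundles using (_↔_; mk↔ₛ′; Inverse)
open import Function.Properties.Inverse using (↔-refl; ↔-sym; ↔-trans)
open import Function.Properties.Inverse.HalfAdjointEquivalence using (_≃_; ↔⇒≃; ≃⇒↔)
open import Function.Related.Propositional using (bijection; module EquationalReasoning)
open import Function.Related.TypeIsomorphisms using (∃∃↔∃∃)
open import Level using (Level; 0ℓ; _⊔_)
open import Relation.Binary.PropositionalEquality
  using (_≡_; _≢_; refl; sym; trans; cong; subst; cong-app; trans-symˡ)

open _≃_
open EquationalReasoning {k = bijection}

private
  variable
    a b c p : Level

-- Contractible types

-- A type with a centre, given as the first component, to which all elements
-- are equal.
IsContr : Set a → Set a
IsContr A = Σ[ x ∈ A ] ((y : A) → x ≡ y)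

IsContr⇒≡ : {A : Set a} → IsContr A → (x y : A) → x ≡ y
IsContr⇒≡ (_ , path) x y = trans (sym (path x)) (path y)

module _ {A : Set a} where

  singleton-IsContr : (x : A) → IsContr (Σ[ y ∈ A ] (x ≡ y))
  singleton-IsContr x = (x , refl) , λ { (_ , refl) → refl }

  singleton′-IsContr : (x : A) → IsContr (Σ[ y ∈ A ] (y ≡ x))
  singleton′-IsContr x = (x , refl) , λ { (_ , refl) → refl }

  -- The second hypothesis is needed only at the centre of the first, and the
  -- centre of the result is the pair of the two centres.
  Σ-IsContr : {B : A → Set b} (cA : IsContr A) → IsContr (B (proj₁ cA)) → IsContr (Σ A B)
  Σ-IsContr {B = B} (x , path) (y , path′) = (x , y) , λ (x′ , y′) → lemma (path x′) y′
    where
    lemma : ∀ {x′} → x ≡ x′ → (y′ : B x′) → (x , y) ≡ (x′ , y′)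
    lemma refl y′ = cong (x ,_) (path′ y′)

  Σ-contract : {B : A → Set b} (cA : IsContr A) → Σ A B ↔ B (proj₁ cA)
  Σ-contract {B = B} cA@(x₀ , _) = mk↔ₛ′
    (λ (x , y) → subst B (to-centre x) y)
    (x₀ ,_)
    (λ y → cong (λ q → subst B q y) (trans-symˡ (proj₂ cA x₀)))
    (λ (x , y) → lemma (to-centre x) y)
    where
    -- Composing with the inverse of the path at x₀ makes this path
    -- reflexivity at the centre.
    to-centre : (x : A) → x ≡ x₀
    to-centre x = IsContr⇒≡ cA x x₀

    lemma : ∀ {x} (q : x ≡ x₀) (y : B x) → (x₀ , subst B q y) ≡ (x , y)
    lemma refl _ = refl

  -- A reflexive family whose total space is contractible is equivalent to the
  -- identity type.
  identity-system : {R : A → Set b} {x : A} (r : R x) →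
    ((z : Σ A R) → (x , r) ≡ z) → (y : A) → (x ≡ y) ↔ R y
  identity-system {R = R} {x} r path y = mk↔ₛ′
    encode
    decode
    (λ r′ → lemma (IsContr⇒≡ total (x , r) (y , r′)))
    (λ { refl → cong (cong proj₁) (trans-symˡ (path (x , r))) })
    where
    total : IsContr (Σ A R)
    total = (x , r) , path

    encode : ∀ {y} → x ≡ y → R y
    encode q = subst R q r

    decode : ∀ {y} → R y → x ≡ y
    decode {y} r′ = cong proj₁ (IsContr⇒≡ total (x , r) (y , r′))

    lemma : ∀ {y r′} (q : (x , r) ≡ (y , r′)) → encode (cong proj₁ q) ≡ r′
    lemma refl = refl

  ≡-congʳ-↔ : {x y y′ : A} → y ≡ y′ → (x ≡ y) ↔ (x ≡ y′)
  ≡-congʳ-↔ refl = ↔-refl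

  ≡-sym-↔ : {x y : A} → (x ≡ y) ↔ (y ≡ x)
  ≡-sym-↔ = mk↔ₛ′ sym sym (λ { refl → refl }) (λ { refl → refl })

-- Dependent sums and products

Σ-cong : {A : Set a} {B : A → Set b} {C : A → Set c} →
  ((x : A) → B x ↔ C x) → Σ A B ↔ Σ A C
Σ-cong h = Σ-↔ ↔-refl (λ {x} → h x)

Π-Σ-choice : {A : Set a} {B : A → Set b} {C : (x : A) → B x → Set c} →
  ((x : A) → Σ (B x) (C x)) ↔ (Σ[ f ∈ ((x : A) → B x) ] ((x : A) → C x (f x)))
Π-Σ-choice = mk↔ₛ′
  (λ f → proj₁ ∘ f , proj₂ ∘ f)
  (λ (f , g) x → f x , g x)
  (λ _ → refl)
  (λ _ → refl)

-- Equivalence induction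

-- In a univalent universe, a property of equivalences out of T x holds if it
-- holds of the identity.
≃-ind : {V : Universe a b} → Univalent V → let open Universe V renaming (El to T) in
  (x : U) (P : (y : U) → T x ≃ T y → Set p) →
  P x ≃-refl → (y : U) (e : T x ≃ T y) → P y e
≃-ind {V = V} uV x P base y e = subst (P y) e-from-path (at-path (from α e))
  where
  open Universe V renaming (El to T)

  α : (x ≡ y) ≃ (T x ≃ T y)
  α = proj₁ (uV x y)

  e-from-path : ≡⇒≃ V x y (from α e) ≡ e
  e-from-path = trans (sym (cong-app (proj₂ (uV x y)) (from α e))) (right-inverse-of α e)

  at-path : ∀ {y} (q : x ≡ y) → P y (≡⇒≃ V x y q)
  at-path refl = base

-- The fibre of f over x. The equality is oriented as in membership.
Fibre : {A : Set a} {X : Set b} → (A → X) → X → Set (a ⊔ b)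
Fibre {A = A} f x = Σ[ i ∈ A ] (x ≡ f i)

-- The half adjoint equivalence structure on a function: A ≃ B is, by η for
-- records, the type of functions from A to B with this structure. The inverse
-- is grouped with its left homotopy because, for the identity, these two form
-- a contractible pair.
IsHAE : {A : Set a} {B : Set b} → (A → B) → Set (a ⊔ b)
IsHAE {A = A} {B = B} f =
  Σ[ (g , l) ∈ (Σ[ g ∈ (B → A) ] ((x : A) → g (f x) ≡ x)) ]
  Σ[ r ∈ ((y : B) → f (g y) ≡ y) ]
    ((x : A) → cong f (l x) ≡ r (f x))

isHAE : {A : Set a} {B : Set b} (e : A ≃ B) → IsHAE (to e)
isHAE e = (from e , left-inverse-of e) , right-inverse-of e , left-right e

≃↔ΣIsHAE : {A : Set a} {B : Set b} → (A ≃ B) ↔ Σ (A → B) IsHAE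
≃↔ΣIsHAE = mk↔ₛ′
  (λ e → to e , isHAE e)
  (λ (f , (g , l) , r , lr) → record
    { to = f ; from = g ; left-inverse-of = l ; right-inverse-of = r ; left-right = lr })
  (λ _ → refl)
  (λ _ → refl)

module FromUnivalence (ua : UnivalenceAxiom 0ℓ) where

  -- Function extensionality

  -- For contractible P x the projection Σ A P → A is an equivalence, and
  -- (x : A) → P x is a retract of the type of its sections.
  Π-IsContr : {A : Set} {P : A → Set} → ((x : A) → IsContr (P x)) → IsContr ((x : A) → P x)
  Π-IsContr {A} {P} cP = (λ x → proj₁ (cP x)) , λ f →
    cong retract (IsContr⇒≡ sections-IsContr (section (λ x → proj₁ (cP x))) (section f))
    where
    first : Σ A P ≃ A
    first = ↔⇒≃ (mk↔ₛ′ proj₁ (λ x → x , proj₁ (cP x)) (λ _ → refl)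
      (λ (x , y) → cong (x ,_) (proj₂ (cP x) y)))

    Sections : Set
    Sections = Σ[ g ∈ (A → Σ A P) ] (proj₁ ∘ g ≡ id)

    -- By equivalence induction, the fibres of postcomposition with an
    -- equivalence are contractible.
    sections-IsContr : IsContr Sections
    sections-IsContr = ≃-ind ua (Σ A P)
      (λ Y e → (f : A → Y) → IsContr (Σ[ g ∈ (A → Σ A P) ] (to e ∘ g ≡ f)))
      singleton′-IsContr A first id

    section : ((x : A) → P x) → Sections
    section f = (λ x → x , f x) , refl

    retract : Sections → (x : A) → P x
    retract (g , q) x = subst P (cong-app q x) (proj₂ (g x))

  homotopy-IsContr : {A : Set} {B : A → Set} (f : (x : A) → B x) →
    IsContr (Σ[ g ∈ ((x : A) → B x) ] ((x : A) → f x ≡ g x))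
  homotopy-IsContr f = (f , λ _ → refl) , λ (g , h) →
    cong (Inverse.to Π-Σ-choice)
      (proj₂ (Π-IsContr (λ x → singleton-IsContr (f x))) (λ x → g x , h x))

  homotopy′-IsContr : {A : Set} {B : A → Set} (f : (x : A) → B x) →
    IsContr (Σ[ g ∈ ((x : A) → B x) ] ((x : A) → g x ≡ f x))
  homotopy′-IsContr f = (f , λ _ → refl) , λ (g , h) →
    cong (Inverse.to Π-Σ-choice)
      (proj₂ (Π-IsContr (λ x → singleton′-IsContr (f x))) (λ x → g x , h x))

  funext : {A : Set} {B : A → Set} {f g : (x : A) → B x} →
    ((x : A) → f x ≡ g x) → f ≡ g
  funext {f = f} {g} h = cong proj₁ (proj₂ (homotopy-IsContr f) (g , h))

  Π-cong : {A : Set} {B C : A → Set} →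
    ((x : A) → B x ↔ C x) → ((x : A) → B x) ↔ ((x : A) → C x)
  Π-cong h = mk↔ₛ′
    (λ f x → Inverse.to (h x) (f x))
    (λ g x → Inverse.from (h x) (g x))
    (λ g → funext λ x → Inverse.strictlyInverseˡ (h x) (g x))
    (λ f → funext λ x → Inverse.strictlyInverseʳ (h x) (f x))

  →-cong : {A A′ B B′ : Set} → A ↔ A′ → B ↔ B′ → (A → B) ↔ (A′ → B′)
  →-cong {A} {A′} {B} {B′} h k = ≃-ind ua A (λ A′ _ → (A → B) ↔ (A′ → B′))
    (Π-cong (λ _ → k)) A′ (↔⇒≃ h)

  -- Being an equivalence

  ≃-cong : {A A′ B B′ : Set} → A ↔ A′ → B ↔ B′ → (A ≃ B) ↔ (A′ ≃ B′)
  ≃-cong {A} {A′} {B} {B′} h k = ≃-ind ua A (λ A′ _ → (A ≃ B) ↔ (A′ ≃ B′))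
    (≃-ind ua B (λ B′ _ → (A ≃ B) ↔ (A ≃ B′)) ↔-refl B′ (↔⇒≃ k)) A′ (↔⇒≃ h)

  IsHAE-id-IsContr : {A : Set} → IsContr (IsHAE {A = A} id)
  IsHAE-id-IsContr =
    Σ-IsContr (homotopy′-IsContr id) (homotopy-IsContr (λ _ → refl))

  -- By equivalence induction it is enough to compare the structures on the
  -- identity.
  IsHAE-irrelevant : {A B : Set} {f : A → B} (h k : IsHAE f) → h ≡ k
  IsHAE-irrelevant {A} {B} {f} h k = ≃-ind ua A
    (λ _ e → (k : IsHAE (to e)) → isHAE e ≡ k)
    (IsContr⇒≡ IsHAE-id-IsContr (isHAE ≃-refl))
    B (Inverse.from ≃↔ΣIsHAE (f , h)) k

  -- Fibrewise maps and fibrewise equivalences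

  -- Fibres are singletons summed over the domain, so a dependent function on
  -- all of them is given by its values at (i , refl).
  Π-Fibre : {A X : Set} {C : X → Set} (f : A → X) →
    ((x : X) → Fibre f x → C x) ↔ ((i : A) → C (f i))
  Π-Fibre f = mk↔ₛ′
    (λ φ i → φ (f i) (i , refl))
    (λ g x → λ { (i , refl) → g i })
    (λ _ → refl)
    (λ φ → funext λ x → funext λ { (i , refl) → refl })

  module _ {A B X : Set} (f : A → X) (g : B → X) where

    -- Fibrewise maps correspond to maps over X.
    fibrewise-map : ((x : X) → Fibre f x → Fibre g x) ↔
                    (Σ[ k ∈ (A → B) ] ((i : A) → f i ≡ g (k i)))
    fibrewise-map = ↔-trans (Π-Fibre f) Π-Σ-choice

  module _ {A X : Set} (f : A → X) where

    private
      -- The map sending (i , refl) to (k i , H i).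
      induced : {B : Set} (g : B → X) (k : A → B) → ((i : A) → f i ≡ g (k i)) →
        (x : X) → Fibre f x → Fibre g x
      induced g k H = Inverse.from (fibrewise-map f g) (k , H)

    -- By induction on the equivalence k and then on the homotopy H, it is
    -- enough to consider the map induced by the identity over f.
    fibrewise-IsHAE : {B : Set} (g : B → X) (k : A → B) (H : (i : A) → f i ≡ g (k i)) →
      IsHAE k → (x : X) → IsHAE (induced g k H x)
    fibrewise-IsHAE {B} g k H h = ≃-ind ua A
      (λ B e → (g : B → X) (H : (i : A) → f i ≡ g (to e i)) →
               (x : X) → IsHAE (induced g (to e) H x))
      (λ g H → over-id (g , H))
      B (Inverse.from ≃↔ΣIsHAE (k , h)) g H
      where
      Over-id : (Σ[ g ∈ (A → X) ] ((i : A) → f i ≡ g i)) → Set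
      Over-id (g , H) = (x : X) → IsHAE (induced g id H x)

      induced-id : (x : X) (z : Fibre f x) → induced f id (λ _ → refl) x z ≡ z
      induced-id x (i , refl) = refl

      over-id : ∀ z → Over-id z
      over-id z = subst Over-id (proj₂ (homotopy-IsContr f) z) λ x →
        isHAE (↔⇒≃ (mk↔ₛ′ (induced f id (λ _ → refl) x) id (induced-id x) (induced-id x)))

    -- The inverse of k at j is the index of the preimage of (j , refl), an
    -- element of the fibre of g over g j.
    total-IsHAE : {B : Set} (g : B → X) (k : A → B) (H : (i : A) → f i ≡ g (k i)) →
      ((x : X) → IsHAE (induced g k H x)) → IsHAE k
    total-IsHAE {B} g k H h = isHAE (↔⇒≃ (mk↔ₛ′ k k⁻¹ k∘k⁻¹ k⁻¹∘k))
      where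
      φ : (x : X) → Fibre f x ≃ Fibre g x
      φ x = Inverse.from ≃↔ΣIsHAE (induced g k H x , h x)

      k⁻¹ : B → A
      k⁻¹ j = proj₁ (from (φ (g j)) (j , refl))

      proj₁-induced : ∀ {x} (z : Fibre f x) → proj₁ (induced g k H x z) ≡ k (proj₁ z)
      proj₁-induced (i , refl) = refl

      k∘k⁻¹ : (j : B) → k (k⁻¹ j) ≡ j
      k∘k⁻¹ j = trans (sym (proj₁-induced (from (φ (g j)) (j , refl))))
                      (cong proj₁ (right-inverse-of (φ (g j)) (j , refl)))

      induced-sym : ∀ {x} i (q : f i ≡ x) →
        to (φ x) (i , sym q) ≡ (k i , trans (sym q) (H i))
      induced-sym i refl = refl

      -- The induced map sends (i , sym (H i)), in the fibre over g (k i), to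
      -- (k i , refl).
      k⁻¹∘k : (i : A) → k⁻¹ (k i) ≡ i
      k⁻¹∘k i = cong proj₁ (trans
        (cong (from (φ (g (k i))))
          (sym (trans (induced-sym i (H i)) (cong (k i ,_) (trans-symˡ (H i))))))
        (left-inverse-of (φ (g (k i))) (i , sym (H i))))

  -- Fibrewise equivalences correspond to equivalences over X.
  fibrewise-≃ : {A B X : Set} (f : A → X) (g : B → X) →
    ((x : X) → Fibre f x ≃ Fibre g x) ↔
    (Σ[ e ∈ A ≃ B ] ((i : A) → f i ≡ g (to e i)))
  fibrewise-≃ {A} {B} {X} f g =
    ((x : X) → Fibre f x ≃ Fibre g x)
      ↔⟨ Π-cong (λ _ → ≃↔ΣIsHAE) ⟩
    ((x : X) → Σ (Fibre f x → Fibre g x) IsHAE)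
      ↔⟨ Π-Σ-choice ⟩
    (Σ[ φ ∈ ((x : X) → Fibre f x → Fibre g x) ] ((x : X) → IsHAE (φ x)))
      ↔⟨ ↔-sym (Σ-↔ (↔-sym (fibrewise-map f g)) (λ {z} → IsHAE↔ z)) ⟩
    (Σ[ (k , _) ∈ (Σ[ k ∈ (A → B) ] ((i : A) → f i ≡ g (k i))) ] IsHAE k)
      ↔⟨ mk↔ₛ′ (λ ((k , H) , h) → (k , h) , H) (λ ((k , h) , H) → (k , H) , h)
               (λ _ → refl) (λ _ → refl) ⟩
    (Σ[ (k , _) ∈ Σ (A → B) IsHAE ] ((i : A) → f i ≡ g (k i)))
      ↔⟨ ↔-sym (Σ-↔ ≃↔ΣIsHAE ↔-refl) ⟩
    (Σ[ e ∈ A ≃ B ] ((i : A) → f i ≡ g (to e i)))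
      ∎
    where
    IsHAE↔ : ((k , H) : Σ[ k ∈ (A → B) ] ((i : A) → f i ≡ g (k i))) →
      IsHAE k ↔ ((x : X) → IsHAE (Inverse.from (fibrewise-map f g) (k , H) x))
    IsHAE↔ (k , H) = mk↔ₛ′
      (fibrewise-IsHAE f g k H)
      (total-IsHAE f g k H)
      (λ _ → funext λ _ → IsHAE-irrelevant _ _)
      (λ _ → IsHAE-irrelevant _ _)

  module InUniverse (V : Universe 0ℓ 0ℓ) (uV : Univalent V) (closed : Closed V) where
    open Universe V renaming (El to T)
    open Closed closed
    open Multisets V closed

    -- Equality of multisets

    =ᴹ-refl : (x : M) → x =ᴹ x
    =ᴹ-refl (sup (a , f)) = ≃-refl , λ i → =ᴹ-refl (f i)

    -- By equivalence induction in the universe the index types agree; the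
    -- elements then agree by the induction hypotheses and extensionality.
    =ᴹ-contract : (x : M) (z : Σ[ y ∈ M ] (x =ᴹ y)) → (x , =ᴹ-refl x) ≡ z
    =ᴹ-contract (sup (a , f)) (sup (b , g) , α , h) = ≃-ind uV a
      (λ b α → (g : T b → M) (h : (i : T a) → f i =ᴹ g (to α i)) →
        _≡_ {A = Σ[ y ∈ M ] (sup (a , f) =ᴹ y)}
          (sup (a , f) , ≃-refl , λ i → =ᴹ-refl (f i)) (sup (b , g) , α , h))
      (λ g h → cong
        (λ k → sup (a , proj₁ ∘ k) , ≃-refl , proj₂ ∘ k)
        (funext {f = λ i → f i , =ᴹ-refl (f i)} {g = λ i → g i , h i}
          λ i → =ᴹ-contract (f i) (g i , h i)))
      b α g h

    =ᴹ↔≡ : {x y : M} → (x =ᴹ y) ↔ (x ≡ y)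
    =ᴹ↔≡ {x} {y} = ↔-sym (identity-system (=ᴹ-refl x) (=ᴹ-contract x) y)

    ∈↔Fibre : {a : U} {f : T a → M} {x : M} → (x ∈ sup (a , f)) ↔ Fibre f x
    ∈↔Fibre = Σ-cong (λ _ → =ᴹ↔≡)

    -- Univalence for Set removes the equivalences between A, B and the decoded
    -- types; what is left is the definition of =ᴹ.
    fromCode-≡ : {A B : Set} (h : HasCode V A) (k : HasCode V B) (f : A → M) (g : B → M) →
      (fromCode h f ≡ fromCode k g) ↔ (Σ[ e ∈ A ≃ B ] ((i : A) → f i ≡ g (to e i)))
    fromCode-≡ {A} {B} (c , α) (d , β) f g = ≃-ind ua (T c)
      (λ A α → (f : A → M) → (fromCode (c , α) f ≡ fromCode (d , β) g) ↔
                              (Σ[ e ∈ A ≃ B ] ((i : A) → f i ≡ g (to e i))))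
      (λ f → ≃-ind ua (T d)
        (λ B β → (g : B → M) → (sup (c , f) ≡ fromCode (d , β) g) ↔
                                (Σ[ e ∈ T c ≃ B ] ((i : T c) → f i ≡ g (to e i))))
        (λ g → ↔-trans (↔-sym =ᴹ↔≡) (Σ-cong λ _ → Π-cong λ _ → =ᴹ↔≡))
        B β g)
      A α f

    -- If A is a set and only equal indices can carry equal elements, then
    -- an equality of multisets indexed by A does not permute the indices.
    fromCode-rigid : {A : Set} → UIP A → (h : HasCode V A) (f g : A → M) →
      ((i j : A) → f i ≡ g j → i ≡ j) →
      (fromCode h f ≡ fromCode h g) ↔ ((i : A) → f i ≡ g i)
    fromCode-rigid {A} uip h f g rigid =
      (fromCode h f ≡ fromCode h g)
        ↔⟨ fromCode-≡ h h f g ⟩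
      (Σ[ e ∈ A ≃ A ] ((i : A) → f i ≡ g (to e i)))
        ↔⟨ Σ-cong (λ _ → Π-cong λ _ → insert) ⟩
      (Σ[ e ∈ A ≃ A ] ((i : A) → Σ[ _ ∈ i ≡ to e i ] (f i ≡ g (to e i))))
        ↔⟨ Σ-cong (λ _ → Π-Σ-choice) ⟩
      (Σ[ e ∈ A ≃ A ] Σ[ _ ∈ ((i : A) → i ≡ to e i) ] ((i : A) → f i ≡ g (to e i)))
        ↔⟨ rearrange ⟩
      (Σ[ ((k , _) , _) ∈ IdentityLike ] ((i : A) → f i ≡ g (k i)))
        ↔⟨ Σ-contract (Σ-IsContr (homotopy-IsContr id) IsHAE-id-IsContr) ⟩
      ((i : A) → f i ≡ g i)
        ∎
      where
      -- Equivalences homotopic to the identity, which form a contractible type.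
      IdentityLike : Set
      IdentityLike = Σ[ (k , _) ∈ (Σ[ k ∈ (A → A) ] ((i : A) → i ≡ k i)) ] IsHAE k

      -- The inserted equality of indices is a proposition that follows from q.
      insert : ∀ {i j} → (f i ≡ g j) ↔ (i ≡ j × f i ≡ g j)
      insert = mk↔ₛ′ (λ q → rigid _ _ q , q) proj₂
        (λ (r , q) → cong (_, q) (uip _ r)) (λ _ → refl)

      rearrange : (Σ[ e ∈ A ≃ A ] Σ[ _ ∈ ((i : A) → i ≡ to e i) ] ((i : A) → f i ≡ g (to e i)))
        ↔ (Σ[ ((k , _) , _) ∈ IdentityLike ] ((i : A) → f i ≡ g (k i)))
      rearrange = mk↔ₛ′
        (λ (e , q , r) → ((to e , q) , isHAE e) , r)
        (λ (((k , q) , h) , r) → Inverse.from ≃↔ΣIsHAE (k , h) , q , r)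
        (λ _ → refl) (λ _ → refl)

    -- Singletons, unordered pairs and ordered pairs

    ⁅⁆-≡ : {x y : M} → (⁅ x ⁆ ≡ ⁅ y ⁆) ↔ (x ≡ y)
    ⁅⁆-≡ {x} {y} = ↔-trans
      (fromCode-rigid (Decidable⇒UIP.≡-irrelevant _≟_) 𝟙-code (const x) (const y)
        (λ _ _ _ → refl))
      (mk↔ₛ′ (λ h → h tt) const (λ _ → refl) (λ _ → refl))

    -- The hypotheses exclude the swap of the two elements.
    &-≡ : {x y x′ y′ : M} → x ≢ y′ → y ≢ x′ →
      (⁅ x & y ⁆ ≡ ⁅ x′ & y′ ⁆) ↔ (x ≡ x′ × y ≡ y′)
    &-≡ {x} {y} {x′} {y′} x≢y′ y≢x′ = ↔-trans
      (fromCode-rigid (Decidable⇒UIP.≡-irrelevant (≡-dec _≟_ _≟_)) 𝟚-code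
        [ const x , const y ] [ const x′ , const y′ ]
        λ { (inj₁ _) (inj₁ _) _ → refl
          ; (inj₁ _) (inj₂ _) q → ⊥-elim (x≢y′ q)
          ; (inj₂ _) (inj₁ _) q → ⊥-elim (y≢x′ q)
          ; (inj₂ _) (inj₂ _) _ → refl })
      (mk↔ₛ′ (λ h → h (inj₁ tt) , h (inj₂ tt))
             (λ (q , r) → λ { (inj₁ _) → q ; (inj₂ _) → r })
             (λ _ → refl)
             (λ _ → funext λ { (inj₁ _) → refl ; (inj₂ _) → refl }))

    ∅-≡-IsContr : IsContr (∅ ≡ ∅)
    ∅-≡-IsContr = Inverse.from ∅-≡ (λ ()) , λ q →
      trans (cong (Inverse.from ∅-≡) (funext λ ())) (Inverse.strictlyInverseʳ ∅-≡ q)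
      where
      ∅-≡ : (∅ ≡ ∅) ↔ ((i : ⊥) → ⊥-elim i ≡ ⊥-elim i)
      ∅-≡ = fromCode-rigid (λ { {()} }) 𝟘-code ⊥-elim ⊥-elim (λ ())

    ⁅⁆≢∅ : {x : M} → ⁅ x ⁆ ≢ ∅
    ⁅⁆≢∅ {x} q = to (proj₁ (Inverse.to (fromCode-≡ 𝟙-code 𝟘-code (const x) ⊥-elim) q)) tt

    -- An equivalence from 2 to 1 would identify the two elements of 2.
    &≢⁅⁆ : {x y z : M} → ⁅ x & y ⁆ ≢ ⁅ z ⁆
    &≢⁅⁆ {x} {y} {z} q
      with injective
             (proj₁ (Inverse.to (fromCode-≡ 𝟚-code 𝟙-code [ const x , const y ] (const z)) q))
             {inj₁ tt} {inj₂ tt} refl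
    ... | ()

    ⟨,⟩-≡ : {x y x′ y′ : M} → (⟨ x , y ⟩ ≡ ⟨ x′ , y′ ⟩) ↔ (x ≡ x′ × y ≡ y′)
    ⟨,⟩-≡ {x} {y} {x′} {y′} =
      (⟨ x , y ⟩ ≡ ⟨ x′ , y′ ⟩)
        ↔⟨ &-≡ &≢⁅⁆ (&≢⁅⁆ ∘ sym) ⟩
      (⁅ ⁅ x ⁆ & ∅ ⁆ ≡ ⁅ ⁅ x′ ⁆ & ∅ ⁆ × ⁅ ⁅ y ⁆ ⁆ ≡ ⁅ ⁅ y′ ⁆ ⁆)
        ↔⟨ ×-cong (&-≡ ⁅⁆≢∅ (⁅⁆≢∅ ∘ sym)) ⁅⁆-≡ ⟩
      ((⁅ x ⁆ ≡ ⁅ x′ ⁆ × ∅ ≡ ∅) × ⁅ y ⁆ ≡ ⁅ y′ ⁆)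
        ↔⟨ ×-cong drop ⁅⁆-≡ ⟩
      (x ≡ x′ × y ≡ y′)
        ∎
      where
      drop : (⁅ x ⁆ ≡ ⁅ x′ ⁆ × ∅ ≡ ∅) ↔ (x ≡ x′)
      drop = ↔-trans
        (mk↔ₛ′ proj₁ (_, proj₁ ∅-≡-IsContr) (λ _ → refl)
               (λ (q , r) → cong (q ,_) (proj₂ ∅-≡-IsContr r)))
        ⁅⁆-≡

    -- Multisets of ordered pairs

    -- The projections of a multiset of pairs have as multiplicities the fibres
    -- of s and t: the other component of a pair is determined by its index.
    module _ {c : U} {r : T c → M} {s t : T c → M} (r≡ : (i : T c) → r i ≡ ⟨ s i , t i ⟩) where

      ⟨,⟩∈ : {x y : M} → (⟨ x , y ⟩ ∈ sup (c , r)) ↔ (Σ[ i ∈ T c ] (x ≡ s i × y ≡ t i))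
      ⟨,⟩∈ {x} {y} =
        (⟨ x , y ⟩ ∈ sup (c , r))                        ↔⟨ ∈↔Fibre ⟩
        (Σ[ i ∈ T c ] (⟨ x , y ⟩ ≡ r i))                 ↔⟨ Σ-cong (λ i → ≡-congʳ-↔ (r≡ i)) ⟩
        (Σ[ i ∈ T c ] (⟨ x , y ⟩ ≡ ⟨ s i , t i ⟩))       ↔⟨ Σ-cong (λ _ → ⟨,⟩-≡) ⟩
        (Σ[ i ∈ T c ] (x ≡ s i × y ≡ t i))               ∎

      domain : {x : M} → (∃[ y ] (⟨ x , y ⟩ ∈ sup (c , r))) ↔ Fibre s x
      domain {x} =
        (∃[ y ] (⟨ x , y ⟩ ∈ sup (c , r)))                ↔⟨ Σ-cong (λ _ → ⟨,⟩∈) ⟩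
        (∃[ y ] Σ[ i ∈ T c ] (x ≡ s i × y ≡ t i))
          ↔⟨ mk↔ₛ′ (λ (y , i , q , q′) → i , (y , q′) , q) (λ (i , (y , q′) , q) → y , i , q , q′)
                   (λ _ → refl) (λ _ → refl) ⟩
        (Σ[ i ∈ T c ] Σ[ _ ∈ (∃[ y ] (y ≡ t i)) ] (x ≡ s i))
          ↔⟨ Σ-cong (λ i → Σ-contract (singleton′-IsContr (t i))) ⟩
        Fibre s x                                         ∎

      range : {y : M} → (∃[ x ] (⟨ x , y ⟩ ∈ sup (c , r))) ↔ Fibre t y
      range {y} =
        (∃[ x ] (⟨ x , y ⟩ ∈ sup (c , r)))                ↔⟨ Σ-cong (λ _ → ⟨,⟩∈) ⟩
        (∃[ x ] Σ[ i ∈ T c ] (x ≡ s i × y ≡ t i))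
          ↔⟨ mk↔ₛ′ (λ (x , i , q , q′) → i , (x , q) , q′) (λ (i , (x , q) , q′) → x , i , q , q′)
                   (λ _ → refl) (λ _ → refl) ⟩
        (Σ[ i ∈ T c ] Σ[ _ ∈ (∃[ x ] (x ≡ s i)) ] (y ≡ t i))
          ↔⟨ Σ-cong (λ i → Σ-contract (singleton′-IsContr (s i))) ⟩
        Fibre t y                                         ∎

    -- Operations as graphs of functions

    module _ {a b : U} (f : T a → M) (g : T b → M) where

      -- The multiset of pairs ⟨f i , g (h i)⟩.
      graph : (T a → T b) → M
      graph h = sup (a , λ i → ⟨ f i , g (h i) ⟩)

      module _ (c : U) (r : T c → M) where

        all-pairs : ((z : M) → z ∈ sup (c , r) → ∃[ x ] ∃[ y ] (z =ᴹ ⟨ x , y ⟩)) ↔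
          (Σ[ s ∈ (T c → M) ] Σ[ t ∈ (T c → M) ] ((i : T c) → r i ≡ ⟨ s i , t i ⟩))
        all-pairs =
          ((z : M) → z ∈ sup (c , r) → ∃[ x ] ∃[ y ] (z =ᴹ ⟨ x , y ⟩))
            ↔⟨ Π-cong (λ _ → →-cong ∈↔Fibre (Σ-cong λ _ → Σ-cong λ _ → =ᴹ↔≡)) ⟩
          ((z : M) → Fibre r z → ∃[ x ] ∃[ y ] (z ≡ ⟨ x , y ⟩))
            ↔⟨ Π-Fibre r ⟩
          ((i : T c) → ∃[ x ] ∃[ y ] (r i ≡ ⟨ x , y ⟩))
            ↔⟨ Π-Σ-choice ⟩
          (Σ[ s ∈ (T c → M) ] ((i : T c) → ∃[ y ] (r i ≡ ⟨ s i , y ⟩)))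
            ↔⟨ Σ-cong (λ _ → Π-Σ-choice) ⟩
          (Σ[ s ∈ (T c → M) ] Σ[ t ∈ (T c → M) ] ((i : T c) → r i ≡ ⟨ s i , t i ⟩))
            ∎

        -- The data of an operation with index type T c, relative to an
        -- equivalence e of the domain with T c: the components s and t of the
        -- pairs, s agreeing with f along e, and t factoring through g by k.
        Indexed : T a ≃ T c → Set
        Indexed e =
          Σ[ (s , _) ∈ (Σ[ s ∈ (T c → M) ] ((i : T a) → f i ≡ s (to e i))) ]
          Σ[ k ∈ (T c → T b) ]
          Σ[ (t , _) ∈ (Σ[ t ∈ (T c → M) ] ((i : T c) → t i ≡ g (k i))) ]
            ((i : T c) → r i ≡ ⟨ s i , t i ⟩)

        Operation↔Indexed : Operation (sup (a , f)) (sup (b , g)) (sup (c , r)) ↔ ∃ Indexed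
        Operation↔Indexed =
          Operation (sup (a , f)) (sup (b , g)) (sup (c , r))
            ↔⟨ ×-cong all-pairs ↔-refl ⟩
          (Pairs × Functional × Valued)
            ↔⟨ Σ-cong (λ (_ , _ , r≡) → ×-cong (functional r≡) (valued r≡)) ⟩
          (Σ[ (s , t , _) ∈ Pairs ]
            ((Σ[ e ∈ T a ≃ T c ] ((i : T a) → f i ≡ s (to e i))) ×
             (Σ[ k ∈ (T c → T b) ] ((i : T c) → t i ≡ g (k i)))))
            ↔⟨ mk↔ₛ′
                 (λ ((s , t , r≡) , (e , f≡) , k , t≡) → e , (s , f≡) , k , (t , t≡) , r≡)
                 (λ (e , (s , f≡) , k , (t , t≡) , r≡) → (s , t , r≡) , (e , f≡) , k , t≡)
                 (λ _ → refl) (λ _ → refl) ⟩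
          ∃ Indexed
            ∎
          where
          Pairs Functional Valued : Set
          Pairs = Σ[ s ∈ (T c → M) ] Σ[ t ∈ (T c → M) ] ((i : T c) → r i ≡ ⟨ s i , t i ⟩)
          Functional = (x : M) → (x ∈ sup (a , f)) ≃ (∃[ y ] (⟨ x , y ⟩ ∈ sup (c , r)))
          Valued = (y : M) → (∃[ x ] (⟨ x , y ⟩ ∈ sup (c , r))) → y ∈ sup (b , g)

          functional : {s t : T c → M} → ((i : T c) → r i ≡ ⟨ s i , t i ⟩) → Functional ↔
            (Σ[ e ∈ T a ≃ T c ] ((i : T a) → f i ≡ s (to e i)))
          functional r≡ = ↔-trans (Π-cong λ _ → ≃-cong ∈↔Fibre (domain r≡)) (fibrewise-≃ _ _)

          valued : {s t : T c → M} → ((i : T c) → r i ≡ ⟨ s i , t i ⟩) → Valued ↔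
            (Σ[ k ∈ (T c → T b) ] ((i : T c) → t i ≡ g (k i)))
          valued r≡ = ↔-trans (Π-cong λ _ → →-cong (range r≡) ∈↔Fibre) (fibrewise-map _ _)

      -- By induction c is a and e is the identity; s is then determined by f,
      -- and t by k.
      Indexed↔graph : (c : U) (e : T a ≃ T c) (r : T c → M) → Indexed c r e ↔
        (Σ[ h ∈ (T a → T b) ] ((i : T a) → ⟨ f i , g (h i) ⟩ =ᴹ r (to e i)))
      Indexed↔graph = ≃-ind uV a
        (λ c e → (r : T c → M) → Indexed c r e ↔
          (Σ[ h ∈ (T a → T b) ] ((i : T a) → ⟨ f i , g (h i) ⟩ =ᴹ r (to e i))))
        λ r →
          Indexed a r ≃-refl
            ↔⟨ Σ-contract (homotopy-IsContr f) ⟩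
          (Σ[ k ∈ (T a → T b) ]
           Σ[ (t , _) ∈ (Σ[ t ∈ (T a → M) ] ((i : T a) → t i ≡ g (k i))) ]
             ((i : T a) → r i ≡ ⟨ f i , t i ⟩))
            ↔⟨ Σ-cong (λ k → Σ-contract (homotopy′-IsContr (g ∘ k))) ⟩
          (Σ[ k ∈ (T a → T b) ] ((i : T a) → r i ≡ ⟨ f i , g (k i) ⟩))
            ↔⟨ Σ-cong (λ _ → Π-cong λ _ → ↔-trans ≡-sym-↔ (↔-sym =ᴹ↔≡)) ⟩
          (Σ[ k ∈ (T a → T b) ] ((i : T a) → ⟨ f i , g (k i) ⟩ =ᴹ r i))
            ∎

      Operation↔graph : (z : M) →
        Operation (sup (a , f)) (sup (b , g)) z ↔ (Σ[ h ∈ (T a → T b) ] (z =ᴹ graph h))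
      Operation↔graph z@(sup (c , r)) =
        Operation (sup (a , f)) (sup (b , g)) z
          ↔⟨ Operation↔Indexed c r ⟩
        ∃ (Indexed c r)
          ↔⟨ Σ-cong (λ e → Indexed↔graph c e r) ⟩
        (Σ[ e ∈ T a ≃ T c ] Σ[ h ∈ (T a → T b) ] ((i : T a) → ⟨ f i , g (h i) ⟩ =ᴹ r (to e i)))
          ↔⟨ ∃∃↔∃∃ _ ⟩
        (Σ[ h ∈ (T a → T b) ] (graph h =ᴹ z))
          ↔⟨ Σ-cong (λ _ → ↔-trans =ᴹ↔≡ (↔-trans ≡-sym-↔ (↔-sym =ᴹ↔≡))) ⟩
        (Σ[ h ∈ (T a → T b) ] (z =ᴹ graph h))
          ∎

    -- The multiset of graphs, indexed by the code for T a → T b.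
    exponential : M → M → M
    exponential (sup (a , f)) (sup (b , g)) = fromCode (Π-code a (λ _ → b)) (graph f g)

    ∈-exponential : (a b z : M) → (z ∈ exponential a b) ≃ Operation a b z
    ∈-exponential (sup (a , f)) (sup (b , g)) z = ↔⇒≃
      (↔-trans (Σ-↔ (≃⇒↔ (proj₂ (Π-code a (λ _ → b)))) ↔-refl)
               (↔-sym (Operation↔graph f g z)))

proposition4 : UnivalenceAxiom 0ℓ →
    (V : Universe 0ℓ 0ℓ) → Univalent V → (closed : Closed V) →
    let open Multisets V closed in
    (a b : M) → Σ[ c ∈ M ] ((z : M) → (z ∈ c) ≃ Operation a b z)
proposition4 ua V uV closed a b = exponential a b , ∈-exponential a b
  where open FromUnivalence.InUniverse ua V uV closed
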